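{- (i) $(\mathcal{N},=,\sim_V)\models\forall\mathsf{x}\forall\mathsf{y}[\mathsf{x}\sim\mathsf{y}\rightarrow(\mathsf{x}=\mathsf{y}\vee\neg(\mathsf{x}=\mathsf{y}))]$, i.e. $\forall\alpha\forall\beta[\alpha\sim_V\beta\rightarrow(\alpha=\beta\vee\neg(\alpha=\beta))]$. (ii) $(\mathcal{N},=,\sim^\omega_V)\models\forall\mathsf{x}\,\neg\forall\mathsf{y}[\mathsf{x}\sim\mathsf{y}\rightarrow(\mathsf{x}=\mathsf{y}\vee\neg(\mathsf{x}=\mathsf{y}))]$, i.e. for every $\gamma$ it is not the case that $\forall\alpha[\gamma\sim^\omega_V\alpha\rightarrow(\gamma=\alpha\vee\neg(\gamma=\alpha))]$.
   Context: Intuitionistic mathematics (constructive reading of logical constants; Markov's Principle not assumed), with Brouwer's Continuity Principle as an axiom (for every $R\subseteq\mathcal{N}\times\omega$, if $\forall\alpha\exists n[\alpha Rn]$ then $\forall\alpha\exists m\exists n\forall\beta[\overline{\alpha}m\sqsubset\beta\rightarrow\beta Rn]$, where $\overline{\alpha}m=\langle\alpha(0),\dots,\alpha(m-1)\rangle$ and $\sqsubset$ is "initial segment of"). $\mathcal{N}=\omega^\omega$, $=$ is equality of sequences. The first-order language has binary relation symbols $=$ (interpreted as equality) and $\sim$ (interpreted by the third component of the structure). $\alpha\sim^0_V\beta$ (also written $\alpha\sim_V\beta$) iff $\exists n\forall m>n[\alpha(m)=\beta(m)]$; $\alpha\sim^{i+1}_V\beta$ iff $\exists n\forall m>n[\alpha(m)\neq\beta(m)\rightarrow\alpha\sim^i_V\beta]$;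 $\alpha\sim^\omega_V\beta$ iff $\exists i[\alpha\sim^i_V\beta]$. -}

module Defs where

open import Data.Empty using (⊥)
open import Data.Fin using (Fin; zero; suc)
open import Data.List using (List; applyUpTo)
open import Data.Nat using (ℕ; zero; suc; _>_)
open import Data.Product using (Σ; _×_)
open import Data.Sum using (_⊎_)
open import Data.Vec using (Vec; []; _∷_; lookup)
open import Level using (0ℓ)
open import Relation.Binary.Core using (Rel)
open import Relation.Binary.PropositionalEquality using (_≡_; _≢_; _≗_)
open import Relation.Nullary using (Irrelevant)

-- Truncation is what separates "there exists" and "or" from Σ and ⊎. The
-- distinction is forced here: with ∃ read as Σ, Brouwer's Continuity Principle
-- is refutable in Martin-Löf type theory (Escardó and Xu, TLCA 2015), because a
-- modulus of continuity would then be a (non-extensional) function of its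
-- argument. Agda without Prop or HITs has no truncation into Set, so it is
-- specified here by its universal property.
record PropositionalTruncation : Set₁ where
  field
    ∥_∥        : Set → Set
    ∣_∣        : {A : Set} → A → ∥ A ∥
    irrelevant : {A : Set} → Irrelevant ∥ A ∥
    rec        : {A P : Set} → Irrelevant P → (A → P) → ∥ A ∥ → P

infix  8 _`=_ _`∼_
infixr 7 _`∧_
infixr 6 _`∨_
infixr 5 _`→_
infix  9 `¬_
infix  4 `∀_ `∃_

-- Formulas with free de Bruijn variables in Fin n; a quantifier binds zero.
data Formula (n : ℕ) : Set where
  _`=_ _`∼_      : Fin n → Fin n → Formula n
  `⊥             : Formula n
  _`∧_ _`∨_ _`→_ : Formula n → Formula n → Formula n
  `∀_ `∃_        : Formula (suc n) → Formula n

`¬_ : {n : ℕ} → Formula n → Formula n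
`¬ φ = φ `→ `⊥

-- The variables x and y of a formula ∀x…∀y[…].
𝗑 𝗒 : Fin 2
𝗑 = suc zero
𝗒 = zero

record Structure : Set₁ where
  constructor ⟨_,_,_⟩
  field
    Carrier : Set
    _≈_     : Rel Carrier 0ℓ
    _∼_     : Rel Carrier 0ℓ

𝒩 : Set
𝒩 = ℕ → ℕ

module IntuitionisticLogic (T : PropositionalTruncation) where
  open PropositionalTruncation T

  infixr 1 _∨_
  infix  4 _⊏_ _⊨_

  _∨_ : Set → Set → Set
  A ∨ B = ∥ A ⊎ B ∥

  ∃ : {A : Set} → (A → Set) → Set
  ∃ {A} P = ∥ Σ A P ∥

  module _ (M : Structure) where
    open Structure M

    Sat : {n : ℕ} → Vec Carrier n → Formula n → Set
    Sat ρ (i `= j) = lookup ρ i ≈ lookup ρ j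
    Sat ρ (i `∼ j) = lookup ρ i ∼ lookup ρ j
    Sat ρ `⊥       = ⊥
    Sat ρ (φ `∧ ψ) = Sat ρ φ × Sat ρ ψ
    Sat ρ (φ `∨ ψ) = Sat ρ φ ∨ Sat ρ ψ
    Sat ρ (φ `→ ψ) = Sat ρ φ → Sat ρ ψ
    Sat ρ (`∀ φ)   = (a : Carrier) → Sat (a ∷ ρ) φ
    Sat ρ (`∃ φ)   = ∃ λ a → Sat (a ∷ ρ) φ

  _⊨_ : Structure → Formula 0 → Set
  M ⊨ φ = Sat M [] φ

  _⊏_ : List ℕ → 𝒩 → Set
  s ⊏ β = ∃ λ n → applyUpTo β n ≡ s

  -- Equality on 𝒩 is pointwise, so a subset of 𝒩 × ω is a proposition-valued
  -- relation that respects it.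
  record IsSubset (R : 𝒩 → ℕ → Set) : Set where
    field
      propositional : ∀ α n → Irrelevant (R α n)
      respects-≗    : ∀ {α β} n → α ≗ β → R α n → R β n

  BrouwersContinuityPrinciple : Set₁
  BrouwersContinuityPrinciple =
    (R : 𝒩 → ℕ → Set) → IsSubset R →
    (∀ α → ∃ λ n → R α n) →
    ∀ α → ∃ λ m → ∃ λ n → ∀ β → applyUpTo α m ⊏ β → R β n

  _∼V^[_]_ : 𝒩 → ℕ → 𝒩 → Set
  α ∼V^[ zero  ] β = ∃ λ n → ∀ m → m > n → α m ≡ β m
  α ∼V^[ suc i ] β = ∃ λ n → ∀ m → m > n → α m ≢ β m → α ∼V^[ i ] β

  _∼V_ : Rel 𝒩 0ℓ
  α ∼V β = α ∼V^[ 0 ] β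

  _∼V^ω_ : Rel 𝒩 0ℓ
  α ∼V^ω β = ∃ λ i → α ∼V^[ i ] β

{-# OPTIONS --safe #-}
-- (i) If α and β agree beyond n, deciding α = β is a finite search up to n.
--
-- (ii) Each α yields a sequence γ′ obtained from γ by changing it at the first
-- place where α is nonzero, if there is one. As γ and γ′ differ at most once,
-- γ ∼V^1 γ′, so a decision of γ = γ′ would, by the Continuity Principle at the
-- zero sequence, be constant on all α starting with some m zeros. But γ = γ′
-- holds for α = 0 and fails for α = 0^m 1 ….
module Submission where

open import Data.Product using (_×_)
open import Relation.Binary.PropositionalEquality using (_≗_)
open import Defs

open import Data.Empty using (⊥-elim)
open import Data.List using (_∷_; applyUpTo)
open import Data.Nat using (ℕ; zero; suc; _+_; _<_; _>_; s≤s⁻¹; s<s⁻¹)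
open import Data.Nat.Properties using (_≟_; _≤?_; allUpTo?; ≰⇒>; +-cancelʳ-≡)
open import Data.Product using (_,_)
open import Data.Sum using (_⊎_; inj₁; inj₂)
open import Function using (const; _∘_)
open import Relation.Binary.PropositionalEquality using (_≡_; _≢_; refl; sym; trans; cong; cong₂)
open import Relation.Nullary using (¬_; Dec; yes; no; Irrelevant)
open import Relation.Nullary.Decidable using (map′)

≗-dec : ∀ {α β : 𝒩} n → (∀ m → m > n → α m ≡ β m) → Dec (α ≗ β)
-- The search bound is `suc n` because `agree` starts strictly beyond `n`, so place `n` itself must
-- be searched.
≗-dec {α} {β} n agree = map′ extend (λ α≗β _ → α≗β _) (allUpTo? (λ m → α m ≟ β m) (suc n))
  where
  extend : (∀ {m} → m < suc n → α m ≡ β m) → α ≗ β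
  extend upTo m with suc m ≤? suc n
  ... | yes m<1+n = upTo m<1+n
  ... | no  m≮1+n = agree m (s≤s⁻¹ (≰⇒> m≮1+n))

ifZero_then_ : ℕ → ℕ → ℕ
ifZero zero  then x = x
ifZero suc _ then x = 0

-- Keeps the first nonzero value of `α` in place and erases all others. Recursing on the shifted
-- sequence avoids searching for a nonzero place that may not exist.
firstNonZero : 𝒩 → 𝒩
firstNonZero α zero    = α 0
firstNonZero α (suc m) = ifZero α 0 then firstNonZero (α ∘ suc) m

firstNonZero-cong : ∀ {α β} → α ≗ β → firstNonZero α ≗ firstNonZero β
firstNonZero-cong α≗β zero    = α≗β 0
firstNonZero-cong α≗β (suc m) = cong₂ ifZero_then_ (α≗β 0) (firstNonZero-cong (α≗β ∘ suc) m)

firstNonZero-unique : ∀ α {m k} → firstNonZero α m ≢ 0 → m < k → firstNonZero α k ≡ 0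
firstNonZero-unique α {zero} {suc k} ≢0 _ with α 0
... | zero  = ⊥-elim (≢0 refl)
... | suc _ = refl
firstNonZero-unique α {suc m} {suc k} ≢0 m<k with α 0
... | zero  = firstNonZero-unique (α ∘ suc) ≢0 (s<s⁻¹ m<k)
... | suc _ = refl

firstNonZero-0 : ∀ m → firstNonZero (const 0) m ≡ 0
firstNonZero-0 zero    = refl
firstNonZero-0 (suc m) = firstNonZero-0 m

-- The tail of ones is harmless: `firstNonZero` erases all but the first.
spike : ℕ → 𝒩
spike zero    _       = 1
spike (suc m) zero    = 0
spike (suc m) (suc k) = spike m k

spike-prefix : ∀ m → applyUpTo (spike m) m ≡ applyUpTo (const 0) m
spike-prefix zero    = refl
spike-prefix (suc m) = cong (0 ∷_) (spike-prefix m)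

firstNonZero-spike : ∀ m → firstNonZero (spike m) m ≡ 1
firstNonZero-spike zero    = refl
firstNonZero-spike (suc m) = firstNonZero-spike m

-- Adding, rather than overwriting, guarantees a change wherever the summand is nonzero, whatever
-- `γ m` is.
perturb : 𝒩 → 𝒩 → 𝒩
perturb γ α m = firstNonZero α m + γ m

perturb-cong : ∀ γ {α β} → α ≗ β → perturb γ α ≗ perturb γ β
perturb-cong γ α≗β m = cong (_+ γ m) (firstNonZero-cong α≗β m)

perturb-fixed : ∀ γ α m → firstNonZero α m ≡ 0 → γ m ≡ perturb γ α m
perturb-fixed γ α m ≡0 = cong (_+ γ m) (sym ≡0)

perturb-0 : ∀ γ → γ ≗ perturb γ (const 0)
perturb-0 γ m = perturb-fixed γ (const 0) m (firstNonZero-0 m)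

perturb-spike : ∀ γ m → ¬ (γ ≗ perturb γ (spike m))
perturb-spike γ m eq
  -- `γ m` is `0 + γ m` by definition, so cancelling `γ m` leaves `0 ≡ 1`.
  with () ← trans (+-cancelʳ-≡ (γ m) 0 _ (eq m)) (firstNonZero-spike m)

module _ (T : PropositionalTruncation) where
  open PropositionalTruncation T
  open IntuitionisticLogic T

  ∼V⇒≗-decidable : ∀ α β → α ∼V β → (α ≗ β) ∨ (¬ (α ≗ β))
  ∼V⇒≗-decidable α β = rec irrelevant λ (n , agree) → ∣ fromDec (≗-dec n agree) ∣
    where
    fromDec : Dec (α ≗ β) → (α ≗ β) ⊎ (¬ (α ≗ β))
    fromDec (yes p) = inj₁ p
    fromDec (no ¬p) = inj₂ ¬p

  perturb-∼V¹ : ∀ γ α → γ ∼V^[ 1 ] perturb γ α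
  -- The outer bound 0 is arbitrary. A difference at `m` makes `firstNonZero α m` nonzero, hence
  -- zero at all later places, so `m` serves as the inner bound.
  perturb-∼V¹ γ α = ∣ 0 , (λ m _ differ → ∣ m , (λ k k>m →
    perturb-fixed γ α k (firstNonZero-unique α (differ ∘ perturb-fixed γ α m) k>m)) ∣) ∣

  module _ (γ : 𝒩) where

    -- A decision of γ = perturb γ α, coded as 0 for "equal" and 1, 2, … for
    -- "not equal". Truncation makes it a proposition without function
    -- extensionality.
    Decides : 𝒩 → ℕ → Set
    Decides α zero    = ∥ γ ≗ perturb γ α ∥
    Decides α (suc _) = ∥ ¬ (γ ≗ perturb γ α) ∥

    Decides-isSubset : IsSubset Decides
    Decides-isSubset = record { propositional = propositional ; respects-≗ = respects }
      where
      propositional : ∀ α n → Irrelevant (Decides α n)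
      propositional α zero    = irrelevant
      propositional α (suc _) = irrelevant

      respects : ∀ {α β} n → α ≗ β → Decides α n → Decides β n
      respects zero α≗β = rec irrelevant λ eq →
        ∣ (λ m → trans (eq m) (perturb-cong γ α≗β m)) ∣
      respects (suc _) α≗β = rec irrelevant λ neq →
        ∣ (λ eq → neq λ m → trans (eq m) (sym (perturb-cong γ α≗β m))) ∣

    -- Code 0 fails at `spike m`, and a positive code fails at `const 0` itself.
    Decides-discontinuous : ∀ m n → ¬ (∀ β → applyUpTo (const 0) m ⊏ β → Decides β n)
    Decides-discontinuous m zero decides =
      rec (λ ()) (perturb-spike γ m) (decides (spike m) ∣ m , spike-prefix m ∣)
    Decides-discontinuous m (suc n) decides =
      rec (λ ()) (λ neq → neq (perturb-0 γ)) (decides (const 0) ∣ m , refl ∣)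

    ∼V^ω-≗-undecidable : BrouwersContinuityPrinciple →
      ¬ (∀ α → γ ∼V^ω α → (γ ≗ α) ∨ (¬ (γ ≗ α)))
    ∼V^ω-≗-undecidable bcp decide =
      rec (λ ()) (λ (m , ∃n) → rec (λ ()) (λ (n , decides) → Decides-discontinuous m n decides) ∃n)
        (bcp Decides Decides-isSubset total (const 0))
      where
      code : ∀ {α} → (γ ≗ perturb γ α) ⊎ (¬ (γ ≗ perturb γ α)) → ∃ (Decides α)
      code (inj₁ eq)  = ∣ 0 , ∣ eq ∣ ∣
      code (inj₂ neq) = ∣ 1 , ∣ neq ∣ ∣

      total : ∀ α → ∃ (Decides α)
      -- The witness 1 is the level `i` in `γ ∼V^[ i ] perturb γ α`.
      total α = rec irrelevant code (decide (perturb γ α) ∣ 1 , perturb-∼V¹ γ α ∣)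

theorem12p1 : (T : PropositionalTruncation) → let open IntuitionisticLogic T in
    BrouwersContinuityPrinciple →
    (⟨ 𝒩 , _≗_ , _∼V_ ⟩ ⊨ (`∀ `∀ (𝗑 `∼ 𝗒 `→ (𝗑 `= 𝗒 `∨ `¬ (𝗑 `= 𝗒)))))
    × (⟨ 𝒩 , _≗_ , _∼V^ω_ ⟩ ⊨ (`∀ `¬ (`∀ (𝗑 `∼ 𝗒 `→ (𝗑 `= 𝗒 `∨ `¬ (𝗑 `= 𝗒))))))
theorem12p1 T bcp = ∼V⇒≗-decidable T , λ γ → ∼V^ω-≗-undecidable T γ bcp
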